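{- Let $\mathrm{a}_{n,k}^{\mathrm{vl}}(123,132)$ denote the number of permutations of $\{1,\dots,n\}$ that avoid both $123$ and $132$ and have exactly $k$ valleys. Then $$\mathrm{a}_{n,k}^{\mathrm{vl}}(123,132)=2\binom{n-1}{2k}.$$
   Context: $\mathcal{S}_n$ is the set of permutations $\pi=\pi_1\cdots\pi_n$ of $\{1,\dots,n\}$. For $\rho\in\mathcal{S}_m$, $\pi\in\mathcal{S}_n$ contains $\rho$ if there are indices $1\le i_1<\cdots<i_m\le n$ such that $\pi_{i_a}<\pi_{i_b}$ if and only if $\rho_a<\rho_b$; otherwise $\pi$ avoids $\rho$. The number of valleys is $\mathrm{vl}(\pi)=|\{i:\pi_i>\pi_{i+1}\text{ and }\pi_{i+1}<\pi_{i+2}\}|$, where $1\le i\le n-2$.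
   Formalization: The formal statement assumes n ≥ 2: for n = 1, k = 0 there is one permutation while the formula gives 2, and for n = 0 the binomial coefficient has upper entry −1; the other excluded cases (n = 1, k ≥ 1) read 0 = 0. -}

module Defs where

open import Data.Fin using (Fin; suc; inject₁; _<_)
open import Data.Fin.Patterns using (0F; 1F; 2F)
open import Data.Fin.Permutation using (Permutation′; _⟨$⟩ʳ_; id; transpose)
open import Data.Fin.Properties using (_<?_)
open import Data.Nat using (ℕ)
open import Data.Nat.Base using (2+)
open import Data.Product using (Σ-syntax; _×_; proj₁)
open import Data.Vec using (allFin; count; map; _∷_; [])
open import Function using (_∘_; Inverse; _⇔_)
open import Level using (0ℓ)
open import Relation.Binary using (Setoid; _Preserves_⟶_)
import Relation.Binary.Construct.On as On
open import Relation.Binary.PropositionalEquality using (_≡_; refl; setoid; _→-setoid_)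
open import Relation.Nullary using (Dec; ¬_)
open import Relation.Nullary.Decidable using (_×-dec_)

-- A permutation π₁⋯πₙ of {1,…,n} is a bijection of Fin n, with positions and
-- values both shifted to start from 0: the entry at position i is π ⟨$⟩ʳ i.

Contains : ∀ {m n} → Permutation′ m → Permutation′ n → Set
Contains {m} {n} ρ π =
  Σ[ i ∈ (Fin m → Fin n) ]
    (i Preserves _<_ ⟶ _<_) ×
    (∀ a b → (π ⟨$⟩ʳ i a < π ⟨$⟩ʳ i b) ⇔ (ρ ⟨$⟩ʳ a < ρ ⟨$⟩ʳ b))

Avoids : ∀ {m n} → Permutation′ m → Permutation′ n → Set
Avoids ρ π = ¬ Contains ρ π

-- For i : Fin n, the positions inject₁ (inject₁ i), suc (inject₁ i) and
-- suc (suc i) of Fin (2+ n) are the consecutive positions i, i + 1 and i + 2.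

IsValley : ∀ {n} → Permutation′ (2+ n) → Fin n → Set
IsValley π i =
  (π ⟨$⟩ʳ suc (inject₁ i) < π ⟨$⟩ʳ inject₁ (inject₁ i)) ×
  (π ⟨$⟩ʳ suc (inject₁ i) < π ⟨$⟩ʳ suc (suc i))

isValley? : ∀ {n} (π : Permutation′ (2+ n)) (i : Fin n) → Dec (IsValley π i)
isValley? π i = (_ <? _) ×-dec (_ <? _)

vl : ∀ {n} → Permutation′ n → ℕ
vl {0}    π = 0
vl {1}    π = 0
vl {2+ n} π = count (isValley? π) (allFin n)

[123] : Permutation′ 3
[123] = id

[132] : Permutation′ 3
[132] = transpose 1F 2F

_ : map ([132] ⟨$⟩ʳ_) (allFin 3) ≡ 0F ∷ 2F ∷ 1F ∷ []
_ = refl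

-- Elements are identified when their underlying permutations agree pointwise,
-- so neither the inverse stored in a permutation nor the proofs of avoidance
-- affect how many elements there are.

AvoidersWithValleys : ∀ {l m} → Permutation′ l → Permutation′ m →
                      ℕ → ℕ → Setoid 0ℓ 0ℓ
AvoidersWithValleys σ τ n k =
  On.setoid {B = Σ[ π ∈ Permutation′ n ] Avoids σ π × Avoids τ π × vl π ≡ k}
            (Fin n →-setoid Fin n)
            (_⟨$⟩ʳ_ ∘ proj₁)

HasCardinality : Setoid 0ℓ 0ℓ → ℕ → Set
HasCardinality S c = Inverse S (setoid (Fin c))

{-# OPTIONS --safe #-}
-- Avoiding 123 and 132 means that every entry has at most one larger entry to
-- its right, so each entry but the last is the largest or the second largest
-- of those not yet used, and the permutation is coded by a word of n − 1 bits
-- (true for the second largest).  The entries at positions i and i + 1 ascend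
-- exactly when bit i is true and bit i + 1 is false or missing, and an ascent
-- is always preceded by a descent.  Hence the first bit is free and the valleys
-- are the maximal runs of true in the other n − 2 bits.  Surrounded by two
-- false bits, that word has 2k places, among n − 1, where the bit changes.
module Submission where

open import Defs
open import Data.Bool using (Bool; true; false; if_then_else_)
open import Data.Fin using (Fin; zero; suc; toℕ; fromℕ; inject₁; punchIn; _<_)
  renaming (_≤_ to _≤ᶠ_)
open import Data.Fin.Patterns using (0F; 1F; 2F)
open import Data.Fin.Permutation
  using (Permutation′; _⟨$⟩ʳ_; _⟨$⟩ˡ_; _≈_; inverseʳ; id; insert; remove; punchIn-permute)
open import Data.Fin.Properties
  using (<-cmp; <-asym; <-irrefl; <-trans; <⇒≢; ≤-antisym; ≤fromℕ;
         fromℕ≢inject₁; toℕ-fromℕ; toℕ-inject₁; toℕ<n; punchIn-injective;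
         punchIn-cancel-≤; suc-injective; 2↔Bool; +↔⊎; *↔×)
open import Data.Nat using (ℕ; zero; suc; 2+; z≤n; s≤s; s<s; z<s; _≤_; _+_; _*_; _∸_)
  renaming (_<_ to _<ℕ_)
open import Data.Nat.Combinatorics using (_C_; nCk+nC[k+1]≡[n+1]C[k+1]; k>n⇒nCk≡0)
import Data.Nat.Properties as ℕ
open import Data.Product using (Σ-syntax; ∃-syntax; _×_; _,_; proj₁; proj₂)
open import Data.Product.Function.NonDependent.Propositional using (_×-↔_)
open import Data.Sum using (_⊎_; inj₁; inj₂)
open import Data.Sum.Function.Propositional using (_⊎-↔_)
open import Data.Vec using (Vec; []; _∷_; lookup; tabulate; count)
open import Function using (_∘_; case_of_; Injection; _↔_; mk⇔; mk↔ₛ′)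
open import Function.Bundles using (Bijection; Equivalence)
open import Function.Construct.Composition using (inverse)
import Function.Construct.Symmetry as Symmetry
open import Function.Properties.Bijection using (Bijection⇒Inverse)
open import Function.Properties.Inverse using (↔⇒↣; ↔-sym; ↔-trans)
open import Function.Related.Propositional using (≡⇒)
open import Relation.Binary using (Setoid; _Preserves_⟶_; tri<; tri≈; tri>)
open import Relation.Binary.PropositionalEquality
open import Relation.Nullary using (¬_; Dec; does; contradiction)
open import Relation.Nullary.Decidable using (does-⇔; dec-true; dec-false)

private
  variable
    m n l : ℕ

-- Strictly monotone maps and the order on `punchIn`

<-mono⇒reflects : (f : Fin m → Fin n) → f Preserves _<_ ⟶ _<_ →
                  ∀ {i j} → f i < f j → i < j
<-mono⇒reflects f mono {i} {j} fi<fj with <-cmp i j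
... | tri< i<j _ _ = i<j
... | tri≈ _ i≡j _ = contradiction fi<fj (<-irrefl (cong f i≡j))
... | tri> _ _ j<i = contradiction (mono j<i) (<-asym fi<fj)

punchIn-mono-< : ∀ i {j k : Fin n} → j < k → punchIn i j < punchIn i k
punchIn-mono-< i {j} {k} j<k =
  ℕ.≰⇒> λ ↑k≤↑j → ℕ.<⇒≱ j<k (punchIn-cancel-≤ i k j ↑k≤↑j)

punchIn-cancel-< : ∀ i {j k : Fin n} → punchIn i j < punchIn i k → j < k
punchIn-cancel-< i = <-mono⇒reflects (punchIn i) (punchIn-mono-< i)

i<punchIn⇒≤ : ∀ (i : Fin (suc n)) k → i < punchIn i k → i ≤ᶠ k
i<punchIn⇒≤ zero    k       _       = z≤n
i<punchIn⇒≤ (suc i) (suc k) (s<s p) = s≤s (i<punchIn⇒≤ i k p)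

≤⇒i<punchIn : ∀ (i : Fin (suc n)) k → i ≤ᶠ k → i < punchIn i k
≤⇒i<punchIn zero    k       _       = z<s
≤⇒i<punchIn (suc i) (suc k) (s≤s p) = s<s (≤⇒i<punchIn i k p)

<⇒punchIn<i : ∀ (i : Fin (suc n)) k → k < i → punchIn i k < i
<⇒punchIn<i (suc i) zero    _       = z<s
<⇒punchIn<i (suc i) (suc k) (s<s p) = s<s (<⇒punchIn<i i k p)

permutation-injective : (π : Permutation′ n) → ∀ {i j} → π ⟨$⟩ʳ i ≡ π ⟨$⟩ʳ j → i ≡ j
permutation-injective π = Injection.injective (↔⇒↣ π)

-- Avoidance of 123 and 132

Thin : Permutation′ n → Set
Thin π = ∀ {a b c} → a < b → a < c →
         π ⟨$⟩ʳ a < π ⟨$⟩ʳ b → π ⟨$⟩ʳ a < π ⟨$⟩ʳ c → b ≡ c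

triple : Fin n → Fin n → Fin n → Fin 3 → Fin n
triple x y z = lookup (x ∷ y ∷ z ∷ [])

triple-mono : ∀ {x y z : Fin n} → x < y → y < z → triple x y z Preserves _<_ ⟶ _<_
triple-mono x<y y<z {0F} {1F} _ = x<y
triple-mono x<y y<z {0F} {2F} _ = <-trans x<y y<z
triple-mono x<y y<z {1F} {2F} _ = y<z
triple-mono x<y y<z {1F} {1F} (s<s ())
triple-mono x<y y<z {2F} {1F} (s<s ())
triple-mono x<y y<z {2F} {2F} (s<s (s<s ()))

-- The values of π along an occurrence i of ρ, listed in increasing order, are v.
contains : (ρ : Permutation′ m) (π : Permutation′ n) (i v : Fin m → Fin n) →
           i Preserves _<_ ⟶ _<_ → v Preserves _<_ ⟶ _<_ →
           (∀ a → π ⟨$⟩ʳ i a ≡ v (ρ ⟨$⟩ʳ a)) → Contains ρ π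
contains ρ π i v i-mono v-mono eq = i , i-mono , λ a b → mk⇔
  (λ p → <-mono⇒reflects v v-mono (subst₂ _<_ (eq a) (eq b) p))
  (λ p → subst₂ _<_ (sym (eq a)) (sym (eq b)) (v-mono p))

-- Two distinct later entries above a given one form 123 or 132 with it, according to whether they
-- ascend or descend. The roles of `b` and `c` are symmetric, so `unordered` serves both orders.
avoids⇒thin : (π : Permutation′ n) → Avoids [123] π → Avoids [132] π → Thin π
avoids⇒thin {n} π ¬123 ¬132 {a} {b} {c} a<b a<c πa<πb πa<πc = case <-cmp b c of λ where
    (tri< b<c _ _) → contradiction b<c (unordered a<b πa<πb πa<πc)
    (tri≈ _ b≡c _) → b≡c
    (tri> _ _ c<b) → contradiction c<b (unordered a<c πa<πc πa<πb)
  where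
  f : Fin n → Fin n
  f = π ⟨$⟩ʳ_

  unordered : ∀ {a b c} → a < b → f a < f b → f a < f c → ¬ b < c
  unordered {a} {b} {c} a<b fa<fb fa<fc b<c with <-cmp (f b) (f c)
  ... | tri< fb<fc _ _ = ¬123 (contains [123] π (triple a b c) (triple (f a) (f b) (f c))
          (triple-mono a<b b<c) (triple-mono fa<fb fb<fc)
          λ { 0F → refl ; 1F → refl ; 2F → refl })
  ... | tri≈ _ fb≡fc _ = <⇒≢ b<c (permutation-injective π fb≡fc)
  ... | tri> _ _ fc<fb = ¬132 (contains [132] π (triple a b c) (triple (f a) (f c) (f b))
          (triple-mono a<b b<c) (triple-mono fa<fc fc<fb)
          λ { 0F → refl ; 1F → refl ; 2F → refl })

-- A pattern starting with its minimum puts two larger entries to the right of one entry. Thinness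
-- would merge their positions, which are strictly increasing.
thin⇒avoids : (ρ : Permutation′ 3) → ρ ⟨$⟩ʳ 0F < ρ ⟨$⟩ʳ 1F → ρ ⟨$⟩ʳ 0F < ρ ⟨$⟩ʳ 2F →
              (π : Permutation′ n) → Thin π → Avoids ρ π
thin⇒avoids ρ ρ0<ρ1 ρ0<ρ2 π thin (i , i-mono , iff) =
  <⇒≢ (i-mono {1F} {2F} (s<s z<s))
    (thin (i-mono {0F} {1F} z<s) (i-mono {0F} {2F} z<s)
      (Equivalence.from (iff 0F 1F) ρ0<ρ1) (Equivalence.from (iff 0F 2F) ρ0<ρ2))

thin-remove : (π : Permutation′ (suc n)) → Thin π → Thin (remove 0F π)
thin-remove π thin a<b a<c πa<πb πa<πc =
  suc-injective (thin (s<s a<b) (s<s a<c) (lift πa<πb) (lift πa<πc))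
  where
  lift : ∀ {a b} → remove 0F π ⟨$⟩ʳ a < remove 0F π ⟨$⟩ʳ b →
         π ⟨$⟩ʳ suc a < π ⟨$⟩ʳ suc b
  lift {a} {b} p = subst₂ _<_ (sym (punchIn-permute π 0F a)) (sym (punchIn-permute π 0F b))
                     (punchIn-mono-< (π ⟨$⟩ʳ 0F) p)

-- Codes

-- A bit is a real choice only while two or more values are left, hence `2+ m`.
lead : Bool → Fin (2+ m)
lead {m} false = fromℕ (suc m)
lead {m} true  = inject₁ (fromℕ m)

lead-injective : ∀ b b′ → lead {m} b ≡ lead b′ → b ≡ b′
lead-injective false false _  = refl
lead-injective true  true  _  = refl
lead-injective false true  eq = contradiction eq fromℕ≢inject₁
lead-injective true  false eq = contradiction (sym eq) fromℕ≢inject₁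

lead-true<lead-false : lead {m} true < lead {m} false
lead-true<lead-false {m} rewrite toℕ-inject₁ (fromℕ m) = ℕ.n<1+n _

lead? : (i : Fin (2+ m)) → (∃[ b ] lead b ≡ i) ⊎ i < lead {m} true
lead? {zero}  0F      = inj₁ (true , refl)
lead? {zero}  1F      = inj₁ (false , refl)
lead? {suc m} 0F      = inj₂ z<s
lead? {suc m} (suc i) with lead? i
... | inj₁ (false , eq) = inj₁ (false , cong suc eq)
... | inj₁ (true  , eq) = inj₁ (true , cong suc eq)
... | inj₂ i<           = inj₂ (s<s i<)

-- Once the leading value is taken out, the others are `punchIn (lead b) k`. Nothing exceeds the
-- largest value, and only the largest exceeds the second largest; it becomes the top value
-- `fromℕ m` after relabelling.
lead<punchIn⇒ : ∀ b (k : Fin (suc m)) → lead {m} b < punchIn (lead b) k →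
                b ≡ true × k ≡ fromℕ m
lead<punchIn⇒ {m} false k p = contradiction
  (ℕ.≤-trans (toℕ<n k) (ℕ.≤-reflexive (sym (toℕ-fromℕ (suc m)))))
  (ℕ.≤⇒≯ (i<punchIn⇒≤ (lead false) k p))
lead<punchIn⇒ {m} true k p = refl , ≤-antisym (≤fromℕ k)
  (subst (_≤ toℕ k) (toℕ-inject₁ (fromℕ m)) (i<punchIn⇒≤ (lead true) k p))

lead-true<punchIn : lead {m} true < punchIn (lead true) (fromℕ m)
lead-true<punchIn {m} = ≤⇒i<punchIn (lead true) (fromℕ m) (ℕ.≤-reflexive (toℕ-inject₁ (fromℕ m)))

decode : Vec Bool m → Permutation′ (suc m)
decode []      = id
decode (b ∷ w) = insert 0F (lead b) (decode w)

decode-thin : (w : Vec Bool m) → Thin (decode w)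
decode-thin [] {0F} {0F} ()
decode-thin (b ∷ w) {0F} {suc _} {suc _} _ _ p q = cong suc (permutation-injective (decode w)
  (trans (proj₂ (lead<punchIn⇒ b _ p)) (sym (proj₂ (lead<punchIn⇒ b _ q)))))
decode-thin (b ∷ w) {suc _} {suc _} {suc _} (s<s a<b) (s<s a<c) p q =
  cong suc (decode-thin w a<b a<c (punchIn-cancel-< (lead b) p) (punchIn-cancel-< (lead b) q))

decode-injective : (v w : Vec Bool m) → decode v ≈ decode w → v ≡ w
decode-injective []      []       _  = refl
decode-injective (b ∷ v) (b′ ∷ w) eq with lead-injective b b′ (eq 0F)
... | refl = cong (b ∷_)
  (decode-injective v w λ k → punchIn-injective (lead b) _ _ (eq (suc k)))

-- If the first entry lay below the two largest values, both would occur to its right, at positions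
-- that thinness forces to coincide.
thin-lead : (π : Permutation′ (2+ m)) → Thin π → ∃[ b ] lead b ≡ π ⟨$⟩ʳ 0F
thin-lead {m} π thin with lead? (π ⟨$⟩ʳ 0F)
... | inj₁ found = found
... | inj₂ below = contradiction same fromℕ≢inject₁
  where
  -- A value above the first entry cannot itself sit at position 0.
  later : ∀ {v} → π ⟨$⟩ʳ 0F < v → zero {suc m} < π ⟨$⟩ˡ v
  later {v} π0<v with π ⟨$⟩ˡ v in eq
  ... | suc _ = z<s
  ... | zero  = contradiction π0<v
    (<-irrefl (trans (cong (π ⟨$⟩ʳ_) (sym eq)) (inverseʳ π)))

  below′ : π ⟨$⟩ʳ 0F < lead false
  below′ = <-trans below lead-true<lead-false

  position : π ⟨$⟩ˡ lead false ≡ π ⟨$⟩ˡ lead true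
  position = thin (later below′) (later below)
    (subst (π ⟨$⟩ʳ 0F <_) (sym (inverseʳ π)) below′)
    (subst (π ⟨$⟩ʳ 0F <_) (sym (inverseʳ π)) below)

  same : lead false ≡ lead true
  same = trans (sym (inverseʳ π)) (trans (cong (π ⟨$⟩ʳ_) position) (inverseʳ π))

decode-surjective : (π : Permutation′ (suc m)) → Thin π → ∃[ w ] decode w ≈ π
decode-surjective {zero}  π thin = [] , λ { 0F → only (π ⟨$⟩ʳ 0F) }
  where
  only : (i : Fin 1) → 0F ≡ i
  only 0F = refl
decode-surjective {suc m} π thin =
  let b , lead≡ = thin-lead π thin
      w , w≈    = decode-surjective (remove 0F π) (thin-remove π thin)
  in b ∷ w , λ where
    0F      → lead≡
    (suc k) → trans (cong₂ punchIn lead≡ (w≈ k)) (sym (punchIn-permute π 0F k))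

-- Valleys

-- Two index maps are allowed so that windows shifted by `suc` can be matched with those of the
-- shorter permutation.
count-tabulate-cong :
  ∀ {A B : Set} {P : A → Set} {Q : B → Set}
  (P? : ∀ x → Dec (P x)) (Q? : ∀ x → Dec (Q x)) (f : Fin n → A) (g : Fin n → B) →
  (∀ i → does (P? (f i)) ≡ does (Q? (g i))) →
  count P? (tabulate f) ≡ count Q? (tabulate g)
count-tabulate-cong {zero}  P? Q? f g eq = refl
count-tabulate-cong {suc n} P? Q? f g eq = cong₂ (λ b c → (if b then suc else λ x → x) c)
  (eq zero) (count-tabulate-cong P? Q? (f ∘ suc) (g ∘ suc) (eq ∘ suc))

vl-cong : (π ρ : Permutation′ n) → π ≈ ρ → vl π ≡ vl ρ
vl-cong {0}    π ρ eq = refl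
vl-cong {1}    π ρ eq = refl
vl-cong {2+ n} π ρ eq = count-tabulate-cong (isValley? π) (isValley? ρ) (λ i → i) (λ i → i)
  λ i → does-⇔ (mk⇔ (valley π ρ eq) (valley ρ π (sym ∘ eq))) (isValley? π i) (isValley? ρ i)
  where
  valley : ∀ (π ρ : Permutation′ (2+ n)) → π ≈ ρ → ∀ {i} → IsValley π i → IsValley ρ i
  valley π ρ eq (p , q) = subst₂ _<_ (eq _) (eq _) p , subst₂ _<_ (eq _) (eq _) q

-- Windows from position 1 on see only the old entries, whose order `punchIn j` preserves; only the
-- window at 0 is new.
vl-insert : ∀ j (ρ : Permutation′ (2+ n)) →
  vl (insert 0F j ρ) ≡ (if does (isValley? (insert 0F j ρ) 0F) then suc else λ x → x) (vl ρ)
vl-insert j ρ = cong (if does (isValley? (insert 0F j ρ) 0F) then suc else λ x → x)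
  (count-tabulate-cong (isValley? (insert 0F j ρ)) (isValley? ρ) suc (λ i → i)
    λ i → does-⇔
      (mk⇔ (λ (p , q) → punchIn-cancel-< j p , punchIn-cancel-< j q)
           (λ (p , q) → punchIn-mono-< j p , punchIn-mono-< j q))
      (isValley? (insert 0F j ρ) (suc i)) (isValley? ρ i))

-- The number of factors "true, false" in the word p w false.
runs : Bool → Vec Bool m → ℕ
runs false []          = 0
runs true  []          = 1
runs p     (true  ∷ w) = runs true w
runs false (false ∷ w) = runs false w
runs true  (false ∷ w) = suc (runs false w)

valley⇒ : ∀ b b′ (w : Vec Bool m) → IsValley (decode (b ∷ b′ ∷ w)) 0F →
          b′ ≡ true × decode w ⟨$⟩ʳ 0F ≡ fromℕ m
valley⇒ b b′ w (_ , q) = lead<punchIn⇒ b′ _ (punchIn-cancel-< (lead b) q)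

⇒valley : ∀ b (w : Vec Bool m) → decode w ⟨$⟩ʳ 0F ≡ fromℕ m →
          IsValley (decode (b ∷ true ∷ w)) 0F
-- The descent is automatic: with one more value available, both choices of `lead b` have a number
-- above that of `lead {m} true`.
⇒valley {m} b w eq = <⇒punchIn<i (lead b) (lead true) (lead-true<lead b) ,
  punchIn-mono-< (lead b)
    (subst (λ k → lead {m} true < punchIn (lead true) k) (sym eq) lead-true<punchIn)
  where
  lead-true<lead : ∀ b → lead {m} true < lead {suc m} b
  lead-true<lead false = ℕ.<-trans (lead-true<lead-false {m}) (ℕ.n<1+n _)
  lead-true<lead true  = subst (toℕ (lead {m} true) <ℕ_) (sym (toℕ-inject₁ (lead {m} false)))
                           (lead-true<lead-false {m})

-- Prepending a bit creates a valley exactly when that bit is `true` and the next is `false` or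
-- missing, which is also when it raises the number of runs: each run is counted at its last `true`.
vl-decode : ∀ b (w : Vec Bool m) → vl (decode (b ∷ w)) ≡ runs false w
vl-decode b [] = refl
vl-decode b (b′ ∷ w) = trans (vl-insert (lead b) (decode (b′ ∷ w)))
  (step b′ w (vl-decode b′ w))
  where
  V? : ∀ b′ (w : Vec Bool l) → Dec (IsValley (decode (b ∷ b′ ∷ w)) 0F)
  V? b′ w = isValley? (decode (b ∷ b′ ∷ w)) 0F

  step : ∀ b′ (w : Vec Bool l) {x} → x ≡ runs false w →
         (if does (V? b′ w) then suc else λ x → x) x ≡ runs false (b′ ∷ w)
  step false w refl
    rewrite dec-false (V? false w) (λ v → case proj₁ (valley⇒ b false w v) of λ ()) = refl
  step true [] refl rewrite dec-true (V? true []) (⇒valley b [] refl) = refl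
  step true (false ∷ w) refl
    rewrite dec-true (V? true (false ∷ w)) (⇒valley b (false ∷ w) refl) = refl
  -- The entry after the would-be bottom is only second largest, so there is no ascent.
  step true (true ∷ w) refl
    rewrite dec-false (V? true (true ∷ w))
      (λ v → fromℕ≢inject₁ (sym (proj₂ (valley⇒ b true (true ∷ w) v)))) = refl

-- Counting words

Words : ℕ → Bool → ℕ → Set
Words m p k = Σ[ w ∈ Vec Bool m ] runs p w ≡ k

-- For words of n − 1 bits: the bit changes an even number of times in
-- false w false and an odd number of times in true w false, at n places.
ways : ℕ → Bool → ℕ → ℕ
ways n false k       = n C (2 * k)
ways n true  zero    = 0
ways n true  (suc k) = n C suc (2 * k)

ways-suc-false : ∀ n k → ways n true k + ways n false k ≡ ways (suc n) false k
ways-suc-false n zero    = refl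
-- Pascal's rule applies once `2 * suc k` is read as `2 + 2 * k`.
ways-suc-false n (suc k) = subst (λ j → n C suc (2 * k) + n C j ≡ suc n C j)
  (sym (ℕ.*-suc 2 k)) (nCk+nC[k+1]≡[n+1]C[k+1] n (suc (2 * k)))

Vec-suc↔ : (P : Vec Bool (suc m) → Set) →
  (Σ[ w ∈ Vec Bool (suc m) ] P w) ↔
  ((Σ[ w ∈ Vec Bool m ] P (true ∷ w)) ⊎ (Σ[ w ∈ Vec Bool m ] P (false ∷ w)))
Vec-suc↔ P = mk↔ₛ′
  (λ { (true ∷ w , p) → inj₁ (w , p) ; (false ∷ w , p) → inj₂ (w , p) })
  (λ { (inj₁ (w , p)) → true ∷ w , p ; (inj₂ (w , p)) → false ∷ w , p })
  (λ { (inj₁ _) → refl ; (inj₂ _) → refl })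
  (λ { (true ∷ w , p) → refl ; (false ∷ w , p) → refl })

empty↔Fin : {A : Set} → ¬ A → n ≡ 0 → A ↔ Fin n
empty↔Fin ¬a refl = mk↔ₛ′ (λ a → contradiction a ¬a) (λ ()) (λ ()) (λ a → contradiction a ¬a)

words-suc↔ : ∀ {A B : Set} → A ↔ Fin m → B ↔ Fin n → m + n ≡ l → (A ⊎ B) ↔ Fin l
words-suc↔ f g eq = ↔-trans (f ⊎-↔ g) (↔-trans (↔-sym +↔⊎) (≡⇒ (cong Fin eq)))

empty-word↔ : ∀ {k} p → runs p [] ≡ k → Words 0 p k ↔ Fin 1
empty-word↔ p eq = mk↔ₛ′ (λ _ → 0F) (λ _ → [] , eq) (λ { zero → refl ; (suc ()) })
  (λ { ([] , eq′) → cong ([] ,_) (ℕ.≡-irrelevant eq eq′) })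

-- Induction on the first bit, which becomes the new preceding bit: a `false` after a `true` closes
-- a run and lowers the count still due. The two cases add up by Pascal's rule; `m` bits between two
-- border bits leave `suc m` places for a change.
words↔ : ∀ m p k → Words m p k ↔ Fin (ways (suc m) p k)
words↔ zero false zero    = empty-word↔ false refl
words↔ zero false (suc k) = empty↔Fin (λ { ([] , ()) }) (k>n⇒nCk≡0 (ℕ.*-monoʳ-≤ 2 (s≤s (z≤n {k}))))
words↔ zero true  0       = empty↔Fin (λ { ([] , ()) }) refl
words↔ zero true  1       = empty-word↔ true refl
words↔ zero true  (2+ k)  = empty↔Fin (λ { ([] , ()) }) (k>n⇒nCk≡0 {k = suc (2 * suc k)} (s≤s (s≤s z≤n)))
words↔ (suc m) false k = ↔-trans (Vec-suc↔ _)
  (words-suc↔ (words↔ m true k) (words↔ m false k) (ways-suc-false (suc m) k))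
-- An open run is eventually closed and counted, so no word has zero runs here.
words↔ (suc m) true zero = ↔-trans (Vec-suc↔ _)
  (words-suc↔ (words↔ m true zero) (empty↔Fin (λ ()) refl) refl)
words↔ (suc m) true (suc k) = ↔-trans (Vec-suc↔ _)
  (words-suc↔ (words↔ m true (suc k)) (↔-trans cancel-suc (words↔ m false k))
    -- The `true` case comes first and gives the odd binomial, so the summands are swapped for
    -- Pascal's rule.
    (trans (ℕ.+-comm _ (suc m C (2 * k))) (nCk+nC[k+1]≡[n+1]C[k+1] (suc m) (2 * k))))
  where
  cancel-suc : (Σ[ w ∈ Vec Bool m ] suc (runs false w) ≡ suc k) ↔ Words m false k
  cancel-suc = mk↔ₛ′
    (λ (w , eq) → w , ℕ.suc-injective eq)
    (λ (w , eq) → w , cong suc eq)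
    (λ (w , _) → cong (w ,_) (ℕ.≡-irrelevant _ _))
    (λ (w , _) → cong (w ,_) (ℕ.≡-irrelevant _ _))

-- Codes of avoiders and the final count

codes-bijection : ∀ m k →
  Bijection (setoid (Bool × Words m false k)) (AvoidersWithValleys [123] [132] (2+ m) k)
codes-bijection m k = record
  { to        = to
  ; cong      = λ { refl _ → refl }
  ; bijective = injective , surjective
  }
  where
  S : Setoid _ _
  S = AvoidersWithValleys [123] [132] (2+ m) k

  to : Bool × Words m false k → Setoid.Carrier S
  to (b , w , eq) = decode (b ∷ w)
    , thin⇒avoids [123] z<s z<s (decode (b ∷ w)) (decode-thin (b ∷ w))
    , thin⇒avoids [132] z<s z<s (decode (b ∷ w)) (decode-thin (b ∷ w))
    , trans (vl-decode b w) eq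

  injective : ∀ {c d} → Setoid._≈_ S (to c) (to d) → c ≡ d
  injective {b , w , eq} {b′ , w′ , eq′} p with decode-injective (b ∷ w) (b′ ∷ w′) p
  -- Equal words may still carry different proofs of the run count; equality on `ℕ` is
  -- proof-irrelevant.
  ... | refl = cong (λ e → b , w , e) (ℕ.≡-irrelevant eq eq′)

  surjective : ∀ x → ∃[ c ] (∀ {d} → d ≡ c → Setoid._≈_ S (to d) x)
  surjective (π , ¬123 , ¬132 , eq) with decode-surjective π (avoids⇒thin π ¬123 ¬132)
  ... | b ∷ w , w≈π =
    (b , w , trans (sym (vl-decode b w)) (trans (vl-cong (decode (b ∷ w)) π w≈π) eq)) ,
    λ { refl → w≈π }

proposition18 : (n k : ℕ) → 2 ≤ n →
    HasCardinality (AvoidersWithValleys [123] [132] n k) (2 * ((n ∸ 1) C (2 * k)))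
proposition18 1      k (s≤s ())
-- The free first bit gives the factor 2, and the other `m` bits give `suc m C (2 * k)`.
proposition18 (2+ m) k _ = inverse (Symmetry.inverse (Bijection⇒Inverse (codes-bijection m k)))
  (↔-trans (↔-sym 2↔Bool ×-↔ words↔ m false k) (↔-sym *↔×))
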